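{- Let $\mu\ge 3$ be an integer and let $S=(x_1,\ldots,x_n;y_1,\ldots,y_m)$ be a bipartite graphic sequence all of whose elements are greater than $\mu-1$. Then $S$ has a realization (a simple bipartite graph with bipartite degree sequence $S$) that is $\mu$-edge-connected.
   Context: All graphs are finite and simple. For a bipartite graph $G$ with bipartition $(X,Y)$, its bipartite degree sequence is $(x_1,\ldots,x_n;y_1,\ldots,y_m)$ where $x_1,\ldots,x_n$ are the degrees of the vertices of $X$ and $y_1,\ldots,y_m$ those of the vertices of $Y$. A sequence of positive integers of this form is a bipartite graphic sequence if some bipartite graph has it as bipartite degree sequence; such a graph is a realization of the sequence. For a nonempty proper subset $S\subset V(G)$, the edge cut $[S,\overline S]$ is the set of edges with one end in $S$ and the other in $V(G)\setminus S$. The edge connectivity $\kappa'(G)$ is the minimum size of an edge cut, and $G$ is $k$-edge-connected if $\kappa'(G)\ge k$. -}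

module Defs where

open import Data.Nat using (ℕ; zero; suc; _+_; _≤_)
open import Data.Fin using (Fin; zero; suc)
open import Data.Bool using (Bool; true; false; if_then_else_; _∧_; _xor_)
open import Data.Sum using (_⊎_; inj₁; inj₂)
open import Data.Product using (Σ; ∃; _×_; _,_)
open import Relation.Binary.PropositionalEquality using (_≡_)

count : ∀ {k} → (Fin k → Bool) → ℕ
count {zero}  p = 0
count {suc k} p = (if p zero then 1 else 0) + count (λ i → p (suc i))

sumF : ∀ {k} → (Fin k → ℕ) → ℕ
sumF {zero}  f = 0
sumF {suc k} f = f zero + sumF (λ i → f (suc i))

-- A (finite, simple) bipartite graph with parts X = Fin n and Y = Fin m,
-- given by its biadjacency relation (simplicity is automatic: at most one
-- edge between x ∈ X and y ∈ Y, no edges inside a part, no loops).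
BipGraph : ℕ → ℕ → Set
BipGraph n m = Fin n → Fin m → Bool

degX : ∀ {n m} → BipGraph n m → Fin n → ℕ
degX G i = count (λ j → G i j)

degY : ∀ {n m} → BipGraph n m → Fin m → ℕ
degY G j = count (λ i → G i j)

Realizes : ∀ {n m} → BipGraph n m → (Fin n → ℕ) → (Fin m → ℕ) → Set
Realizes G xs ys = (∀ i → degX G i ≡ xs i) × (∀ j → degY G j ≡ ys j)

BipartiteGraphic : ∀ {n m} → (Fin n → ℕ) → (Fin m → ℕ) → Set
BipartiteGraphic {n} {m} xs ys = Σ (BipGraph n m) λ G → Realizes G xs ys

VSubset : ℕ → ℕ → Set
VSubset n m = Fin n ⊎ Fin m → Bool

NonemptyProper : ∀ {n m} → VSubset n m → Set
NonemptyProper {n} {m} S =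
  (Σ (Fin n ⊎ Fin m) λ v → S v ≡ true) × (Σ (Fin n ⊎ Fin m) λ v → S v ≡ false)

cutSize : ∀ {n m} → BipGraph n m → VSubset n m → ℕ
cutSize G S = sumF (λ i → count (λ j → G i j ∧ (S (inj₁ i) xor S (inj₂ j))))

EdgeConnected : ∀ {n m} → ℕ → BipGraph n m → Set
EdgeConnected {n} {m} k G = ∀ (S : VSubset n m) → NonemptyProper S → k ≤ cutSize G S

{-# OPTIONS --safe #-}

-- Suppose that every cut has at least k < μ edges and that T has exactly k.  Let P ⊆ T and
-- Q ⊆ ∁ T be minimal with cut k.  Switching an edge uv inside P and an edge xy inside Q to
-- uy and xv adds 2 to the cut of T, and lowers (by 2) only cuts S that separate both u from v
-- and x from y.  Such a cut contains the edges by which S splits P and Q; by minimality there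
-- are at least (k + 2) / 2 of either kind.  Choosing uv inside a set A ⊆ P that is minimal among
-- those with cut ≤ k + 1 containing an edge, so that u and v have many neighbours in P,
-- improves the bound for P to (k + 3) / 2.  So S had at least k + 3 edges and keeps k + 1.
-- Doing this for every T in turn raises all cuts to k + 1.

module Submission where

open import Defs
open import Data.Nat using (ℕ; zero; suc; _+_; _*_; _∸_; _≤_; _<_; z≤n; s≤s; s≤s⁻¹; _≤?_; _<?_) renaming (_≟_ to _≟ℕ_)
open import Data.Nat.Properties hiding (_≟_)
open import Data.Nat.Solver using (module +-*-Solver)
open import Data.Fin using (Fin; zero; suc; _≟_)
open import Data.Fin.Properties using (any?; all?)
open import Data.Bool using (Bool; true; false; if_then_else_; _∧_; _xor_; not)
open import Data.Bool.Properties using (¬-not) renaming (_≟_ to _≟ᵇ_)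
open import Data.Empty using (⊥; ⊥-elim)
open import Data.List using (List; []; _∷_; cartesianProductWith)
open import Data.List.Relation.Unary.Any as Any using (Any; here; there)
open import Data.List.Relation.Unary.Any.Properties using (cartesianProductWith⁺)
open import Data.List.Relation.Unary.All as All using (All; []; _∷_)
open import Data.Product using (Σ; ∃; _×_; _,_; proj₁; proj₂)
open import Data.Sum using (_⊎_; inj₁; inj₂; [_,_])
import Data.Vec.Functional as Vector
open import Function using (_∘_; case_of_)
open import Relation.Binary.PropositionalEquality hiding ([_])
open import Relation.Nullary using (¬_; Dec; yes; no; does; contradiction)
open import Relation.Nullary.Decidable using (map′; toWitness; toWitnessFalse; ¬?; _×-dec_; _→-dec_; _⊎-dec_)

-- Finite sums, point masses and truth values as numbers

sumF-cong : ∀ {n} {f g : Fin n → ℕ} → (∀ i → f i ≡ g i) → sumF f ≡ sumF g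
sumF-cong {zero}  eq = refl
sumF-cong {suc n} eq = cong₂ _+_ (eq zero) (sumF-cong (eq ∘ suc))

sumF-mono : ∀ {n} {f g : Fin n → ℕ} → (∀ i → f i ≤ g i) → sumF f ≤ sumF g
sumF-mono {zero}  le = z≤n
sumF-mono {suc n} le = +-mono-≤ (le zero) (sumF-mono (le ∘ suc))

sumF-strictMono : ∀ {n} {f g : Fin n → ℕ} → (∀ i → f i ≤ g i) → ∀ i → f i < g i → sumF f < sumF g
sumF-strictMono le zero    lt = +-mono-<-≤ lt (sumF-mono (le ∘ suc))
sumF-strictMono le (suc i) lt = +-mono-≤-< (le zero) (sumF-strictMono (le ∘ suc) i lt)

sumF-zero : ∀ n → sumF {n} (λ _ → 0) ≡ 0
sumF-zero zero    = refl
sumF-zero (suc n) = sumF-zero n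

*-swap : ∀ a b c → a * (b * c) ≡ b * (a * c)
*-swap = solve 3 (λ a b c → a :* (b :* c) := b :* (a :* c)) refl
  where open +-*-Solver

+-interchange : ∀ a b c d → (a + b) + (c + d) ≡ (a + c) + (b + d)
+-interchange = solve 4 (λ a b c d → (a :+ b) :+ (c :+ d) := (a :+ c) :+ (b :+ d)) refl
  where open +-*-Solver

sumF-+ : ∀ {n} (f g : Fin n → ℕ) → sumF (λ i → f i + g i) ≡ sumF f + sumF g
sumF-+ {zero}  f g = refl
sumF-+ {suc n} f g =
  trans (cong (f zero + g zero +_) (sumF-+ (f ∘ suc) (g ∘ suc)))
        (+-interchange (f zero) (g zero) (sumF (f ∘ suc)) (sumF (g ∘ suc)))

sumF-*ˡ : ∀ {n} c (f : Fin n → ℕ) → sumF (λ i → c * f i) ≡ c * sumF f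
sumF-*ˡ {zero}  c f = sym (*-zeroʳ c)
sumF-*ˡ {suc n} c f =
  trans (cong (c * f zero +_) (sumF-*ˡ c (f ∘ suc))) (sym (*-distribˡ-+ c (f zero) (sumF (f ∘ suc))))

sumF-swap : ∀ {n m} (f : Fin n → Fin m → ℕ) →
  sumF (λ i → sumF (λ j → f i j)) ≡ sumF (λ j → sumF (λ i → f i j))
sumF-swap {zero}  {m} f = sym (sumF-zero m)
sumF-swap {suc n} f =
  trans (cong (sumF (f zero) +_) (sumF-swap (f ∘ suc)))
        (sym (sumF-+ (f zero) (λ j → sumF (λ i → f (suc i) j))))

term≤sumF : ∀ {n} (f : Fin n → ℕ) i → f i ≤ sumF f
term≤sumF f zero    = m≤m+n _ _
term≤sumF f (suc i) = ≤-trans (term≤sumF (f ∘ suc) i) (m≤n+m _ _)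

-- The Kronecker delta, by recursion on both indices, so that `sumF-δ` follows by the same recursion
-- without deciding equality.
δ : ∀ {n} → Fin n → Fin n → ℕ
δ zero    zero    = 1
δ zero    (suc i) = 0
δ (suc u) zero    = 0
δ (suc u) (suc i) = δ u i

δ-≡ : ∀ {n} (u : Fin n) → δ u u ≡ 1
δ-≡ zero    = refl
δ-≡ (suc u) = δ-≡ u

δ-≢ : ∀ {n} {u i : Fin n} → u ≢ i → δ u i ≡ 0
δ-≢ {u = zero}  {zero}  ne = contradiction refl ne
δ-≢ {u = zero}  {suc i} ne = refl
δ-≢ {u = suc u} {zero}  ne = refl
δ-≢ {u = suc u} {suc i} ne = δ-≢ (ne ∘ cong suc)

sumF-δ : ∀ {n} (u : Fin n) (f : Fin n → ℕ) → sumF (λ i → δ u i * f i) ≡ f u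
sumF-δ {suc n} zero    f = trans (cong₂ _+_ (+-identityʳ _) (sumF-zero n)) (+-identityʳ _)
sumF-δ {suc n} (suc u) f = sumF-δ u (f ∘ suc)

b2n : Bool → ℕ
b2n b = if b then 1 else 0

count≡sumF : ∀ {n} (p : Fin n → Bool) → count p ≡ sumF (λ i → b2n (p i))
count≡sumF {zero}  p = refl
count≡sumF {suc n} p = cong (b2n (p zero) +_) (count≡sumF (p ∘ suc))

b2n-∧ : ∀ a b → b2n (a ∧ b) ≡ b2n a * b2n b
b2n-∧ false b = refl
b2n-∧ true  b = sym (+-identityʳ _)

b2n-mono : ∀ {a b} → (a ≡ true → b ≡ true) → b2n a ≤ b2n b
b2n-mono {false}     h = z≤n
b2n-mono {true}  {b} h rewrite h refl = ≤-refl

b2n-*-mono : ∀ b {x y} → (b ≡ true → x ≤ y) → b2n b * x ≤ b2n b * y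
b2n-*-mono false h = z≤n
b2n-*-mono true  h = +-mono-≤ (h refl) z≤n

∧-true : ∀ {a b} → a ∧ b ≡ true → a ≡ true × b ≡ true
∧-true {true} {true} refl = refl , refl

-- Combined with `toWitness`, this settles a claim about finitely many truth values by evaluating
-- its truth table. The comparisons at a single edge are proved in this way.
∀ᵇ? : ∀ {P : Bool → Set} → (∀ b → Dec (P b)) → Dec (∀ b → P b)
∀ᵇ? P? = map′ (λ { (t , f) true → t ; (t , f) false → f }) (λ h → h true , h false) (P? true ×-dec P? false)

-- Weighted edge counts

-- Degrees and cuts both have this form for suitable weights, so one identity for switching serves
-- both, and inequalities between cuts reduce to a single edge.
edgeSum : ∀ {n m} → BipGraph n m → (Fin n → Fin m → ℕ) → ℕ
edgeSum G f = sumF λ i → sumF λ j → b2n (G i j) * f i j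

edgeSum-cong : ∀ {n m} (G : BipGraph n m) {f g : Fin n → Fin m → ℕ} →
  (∀ i j → f i j ≡ g i j) → edgeSum G f ≡ edgeSum G g
edgeSum-cong G eq = sumF-cong λ i → sumF-cong λ j → cong (b2n (G i j) *_) (eq i j)

edgeSum-mono : ∀ {n m} (G : BipGraph n m) {f g : Fin n → Fin m → ℕ} →
  (∀ i j → G i j ≡ true → f i j ≤ g i j) → edgeSum G f ≤ edgeSum G g
edgeSum-mono G le = sumF-mono λ i → sumF-mono λ j → b2n-*-mono (G i j) (le i j)

sum₂-+ : ∀ {n m} (f g : Fin n → Fin m → ℕ) →
  (sumF λ i → sumF λ j → f i j + g i j) ≡ (sumF λ i → sumF λ j → f i j) + (sumF λ i → sumF λ j → g i j)
sum₂-+ f g = trans (sumF-cong λ i → sumF-+ (f i) (g i)) (sumF-+ (λ i → sumF (f i)) (λ i → sumF (g i)))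

edgeSum-+ : ∀ {n m} (G : BipGraph n m) (f g : Fin n → Fin m → ℕ) →
  edgeSum G (λ i j → f i j + g i j) ≡ edgeSum G f + edgeSum G g
edgeSum-+ G f g =
  trans (sumF-cong λ i → sumF-cong λ j → *-distribˡ-+ (b2n (G i j)) (f i j) (g i j))
        (sum₂-+ (λ i j → b2n (G i j) * f i j) (λ i j → b2n (G i j) * g i j))

edgeSum-*ˡ : ∀ {n m} (G : BipGraph n m) c (f : Fin n → Fin m → ℕ) →
  edgeSum G (λ i j → c * f i j) ≡ c * edgeSum G f
edgeSum-*ˡ G c f =
  trans (sumF-cong λ i →
           trans (sumF-cong λ j → *-swap (b2n (G i j)) c (f i j)) (sumF-*ˡ c (λ j → b2n (G i j) * f i j)))
        (sumF-*ˡ c (λ i → sumF λ j → b2n (G i j) * f i j))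

sum₂-δ : ∀ {n m} (u : Fin n) (v : Fin m) (f : Fin n → Fin m → ℕ) →
  (sumF λ i → sumF λ j → δ u i * δ v j * f i j) ≡ f u v
sum₂-δ u v f =
  trans (sumF-cong λ i →
           trans (sumF-cong λ j → *-assoc (δ u i) (δ v j) (f i j))
                 (trans (sumF-*ˡ (δ u i) (λ j → δ v j * f i j)) (cong (δ u i *_) (sumF-δ v (f i)))))
        (sumF-δ u (λ i → f i v))

degX≡edgeSum : ∀ {n m} (G : BipGraph n m) i → degX G i ≡ edgeSum G (λ i′ _ → δ i i′)
degX≡edgeSum G i = trans (count≡sumF (G i)) (sym (trans
  (sumF-cong λ i′ → trans (sumF-cong λ j → *-comm (b2n (G i′ j)) (δ i i′))
                          (sumF-*ˡ (δ i i′) (λ j → b2n (G i′ j))))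
  (sumF-δ i (λ i′ → sumF λ j → b2n (G i′ j)))))

degY≡edgeSum : ∀ {n m} (G : BipGraph n m) j → degY G j ≡ edgeSum G (λ _ j′ → δ j j′)
degY≡edgeSum G j = trans (count≡sumF (λ i → G i j)) (sumF-cong λ i → sym
  (trans (sumF-cong λ j′ → *-comm (b2n (G i j′)) (δ j j′)) (sumF-δ j (λ j′ → b2n (G i j′)))))

-- Vertex sets and cuts

Vertex : ℕ → ℕ → Set
Vertex n m = Fin n ⊎ Fin m

_⊆_ : ∀ {n m} → VSubset n m → VSubset n m → Set
S ⊆ T = ∀ v → S v ≡ true → T v ≡ true

_∩_ _∖_ : ∀ {n m} → VSubset n m → VSubset n m → VSubset n m
(S ∩ T) v = S v ∧ T v
(S ∖ T) v = S v ∧ not (T v)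

∁ : ∀ {n m} → VSubset n m → VSubset n m
∁ S v = not (S v)

Nonempty : ∀ {n m} → VSubset n m → Set
Nonempty S = ∃ λ v → S v ≡ true

anyVertex? : ∀ {n m} {P : Vertex n m → Set} → (∀ v → Dec (P v)) → Dec (∃ P)
anyVertex? P? = map′
  (λ { (inj₁ (i , p)) → inj₁ i , p ; (inj₂ (j , p)) → inj₂ j , p })
  (λ { (inj₁ i , p) → inj₁ (i , p) ; (inj₂ j , p) → inj₂ (j , p) })
  (any? (P? ∘ inj₁) ⊎-dec any? (P? ∘ inj₂))

nonempty? : ∀ {n m} (S : VSubset n m) → Dec (Nonempty S)
nonempty? S = anyVertex? λ v → S v ≟ᵇ true

cut : ∀ {n m} → BipGraph n m → VSubset n m → ℕ
cut G S = edgeSum G λ i j → b2n (S (inj₁ i) xor S (inj₂ j))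

cutSize≡cut : ∀ {n m} (G : BipGraph n m) S → cutSize G S ≡ cut G S
cutSize≡cut G S = sumF-cong λ i →
  trans (count≡sumF (λ j → G i j ∧ (S (inj₁ i) xor S (inj₂ j)))) (sumF-cong λ j → b2n-∧ (G i j) _)

cut-cong : ∀ {n m} (G : BipGraph n m) {S T : VSubset n m} → S ≗ T → cut G S ≡ cut G T
cut-cong G eq = edgeSum-cong G λ i j → cong₂ (λ a b → b2n (a xor b)) (eq _) (eq _)

-- The number of edges with both ends in `P` that `S` separates.
split : ∀ {n m} → BipGraph n m → VSubset n m → VSubset n m → ℕ
split G P S = edgeSum G λ i j → b2n (P (inj₁ i) ∧ P (inj₂ j) ∧ (S (inj₁ i) xor S (inj₂ j)))

-- An edge leaving `P` leaves exactly one of the two parts into which `S` divides `P`; an edge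
-- between the parts leaves both.
cut-∩-∖ : ∀ {n m} (G : BipGraph n m) P S →
  cut G (P ∩ S) + cut G (P ∖ S) ≡ cut G P + 2 * split G P S
cut-∩-∖ G P S =
  trans (sym (edgeSum-+ G _ _))
  (trans (edgeSum-cong G λ i j → pointwise (P (inj₁ i)) (P (inj₂ j)) (S (inj₁ i)) (S (inj₂ j)))
  (trans (edgeSum-+ G _ _) (cong (cut G P +_) (edgeSum-*ˡ G 2 _))))
  where
  pointwise : ∀ p p′ s s′ →
    b2n ((p ∧ s) xor (p′ ∧ s′)) + b2n ((p ∧ not s) xor (p′ ∧ not s′)) ≡
    b2n (p xor p′) + 2 * b2n (p ∧ p′ ∧ (s xor s′))
  pointwise = toWitness {a? = ∀ᵇ? λ p → ∀ᵇ? λ p′ → ∀ᵇ? λ s → ∀ᵇ? λ s′ → _ ≟ℕ _} _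

-- Posimodularity of the cut function; it suffices to compare the contributions of one edge.
cut-posimodular : ∀ {n m} (G : BipGraph n m) A B → cut G (A ∖ B) + cut G (B ∖ A) ≤ cut G A + cut G B
cut-posimodular G A B =
  subst₂ _≤_ (edgeSum-+ G _ _) (edgeSum-+ G _ _)
    (edgeSum-mono G λ i j _ → pointwise (A (inj₁ i)) (A (inj₂ j)) (B (inj₁ i)) (B (inj₂ j)))
  where
  pointwise : ∀ a a′ b b′ →
    b2n ((a ∧ not b) xor (a′ ∧ not b′)) + b2n ((b ∧ not a) xor (b′ ∧ not a′)) ≤
    b2n (a xor a′) + b2n (b xor b′)
  pointwise = toWitness {a? = ∀ᵇ? λ a → ∀ᵇ? λ a′ → ∀ᵇ? λ b → ∀ᵇ? λ b′ → _ ≤? _} _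

-- No edge lies inside both of two disjoint sets, so no edge of the cut of `S` is counted twice on
-- the left.
split+split≤cut : ∀ {n m} (G : BipGraph n m) {P Q} S → Q ⊆ ∁ P →
  split G P S + split G Q S ≤ cut G S
split+split≤cut G {P} {Q} S Q⊆∁P =
  ≤-trans (≤-reflexive (sym (edgeSum-+ G _ _)))
    (edgeSum-mono G λ i j _ → pointwise (P (inj₁ i)) (P (inj₂ j)) (Q (inj₁ i)) (Q (inj₂ j)) (S (inj₁ i)) (S (inj₂ j))
      (Q⊆∁P _))
  where
  pointwise : ∀ p p′ q q′ s s′ → (q ≡ true → not p ≡ true) →
    b2n (p ∧ p′ ∧ (s xor s′)) + b2n (q ∧ q′ ∧ (s xor s′)) ≤ b2n (s xor s′)
  pointwise = toWitness {a? = ∀ᵇ? λ p → ∀ᵇ? λ p′ → ∀ᵇ? λ q → ∀ᵇ? λ q′ → ∀ᵇ? λ s → ∀ᵇ? λ s′ →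
    (_ ≟ᵇ _ →-dec _ ≟ᵇ _) →-dec _ ≤? _} _

cut-∁ : ∀ {n m} (G : BipGraph n m) S → cut G (∁ S) ≡ cut G S
cut-∁ G S = edgeSum-cong G λ i j → pointwise (S (inj₁ i)) (S (inj₂ j))
  where
  pointwise : ∀ s s′ → b2n (not s xor not s′) ≡ b2n (s xor s′)
  pointwise = toWitness {a? = ∀ᵇ? λ s → ∀ᵇ? λ s′ → _ ≟ℕ _} _

-- Searching over vertex sets

allFuns : ∀ n → List (Fin n → Bool)
allFuns zero    = (λ ()) ∷ []
allFuns (suc n) = cartesianProductWith Vector._∷_ (true ∷ false ∷ []) (allFuns n)

allFuns-complete : ∀ {n} (f : Fin n → Bool) → Any (_≗ f) (allFuns n)
allFuns-complete {zero}  f = here λ ()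
allFuns-complete {suc n} f =
  cartesianProductWith⁺ Vector._∷_ (λ { b≡ g≗ zero → b≡ ; b≡ g≗ (suc i) → g≗ i })
    (bool (f zero)) (allFuns-complete (f ∘ suc))
  where
  bool : ∀ b → Any (_≡ b) (true ∷ false ∷ [])
  bool true  = here refl
  bool false = there (here refl)

allSubsets : ∀ n m → List (VSubset n m)
allSubsets n m = cartesianProductWith [_,_] (allFuns n) (allFuns m)

allSubsets-complete : ∀ {n m} (S : VSubset n m) → Any (_≗ S) (allSubsets n m)
allSubsets-complete S =
  cartesianProductWith⁺ [_,_] (λ { f≗ g≗ (inj₁ i) → f≗ i ; f≗ g≗ (inj₂ j) → g≗ j })
    (allFuns-complete (S ∘ inj₁)) (allFuns-complete (S ∘ inj₂))

-- Sets are functions, and the enumeration meets a set only up to pointwise equality; a property to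
-- be searched for has to respect it.
Respects-≗ : ∀ {n m} → (VSubset n m → Set) → Set
Respects-≗ D = ∀ {S T} → S ≗ T → D S → D T

anySubset? : ∀ {n m} {D : VSubset n m → Set} → Respects-≗ D → (∀ S → Dec (D S)) → Dec (∃ D)
anySubset? {n} {m} resp D? =
  map′ Any.satisfied
       (λ (S , d) → Any.map (λ eq → resp (λ v → sym (eq v)) d) (allSubsets-complete S))
       (Any.any? D? (allSubsets n m))

sumV : ∀ {n m} → (Vertex n m → ℕ) → ℕ
sumV f = sumF (f ∘ inj₁) + sumF (f ∘ inj₂)

sumV-cong : ∀ {n m} {f g : Vertex n m → ℕ} → (∀ v → f v ≡ g v) → sumV f ≡ sumV g
sumV-cong eq = cong₂ _+_ (sumF-cong (eq ∘ inj₁)) (sumF-cong (eq ∘ inj₂))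

sumV-mono : ∀ {n m} {f g : Vertex n m → ℕ} → (∀ v → f v ≤ g v) → sumV f ≤ sumV g
sumV-mono le = +-mono-≤ (sumF-mono (le ∘ inj₁)) (sumF-mono (le ∘ inj₂))

size : ∀ {n m} → VSubset n m → ℕ
size S = sumV (b2n ∘ S)

size-cong : ∀ {n m} {S T : VSubset n m} → S ≗ T → size S ≡ size T
size-cong eq = cong₂ _+_ (sumF-cong λ i → cong b2n (eq (inj₁ i))) (sumF-cong λ j → cong b2n (eq (inj₂ j)))

size-< : ∀ {n m} {S T : VSubset n m} → S ⊆ T → ∀ v → S v ≡ false → T v ≡ true → size S < size T
size-< S⊆T (inj₁ i) Sv Tv = +-mono-<-≤
  (sumF-strictMono (λ i → b2n-mono (S⊆T (inj₁ i))) i (subst₂ (λ a b → b2n a < b2n b) (sym Sv) (sym Tv) ≤-refl))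
  (sumF-mono λ j → b2n-mono (S⊆T (inj₂ j)))
size-< S⊆T (inj₂ j) Sv Tv = +-mono-≤-<
  (sumF-mono λ i → b2n-mono (S⊆T (inj₁ i)))
  (sumF-strictMono (λ j → b2n-mono (S⊆T (inj₂ j))) j (subst₂ (λ a b → b2n a < b2n b) (sym Sv) (sym Tv) ≤-refl))

∩-⊆ˡ : ∀ {n m} (S T : VSubset n m) → (S ∩ T) ⊆ S
∩-⊆ˡ S T v eq = proj₁ (∧-true eq)

⊆-trans : ∀ {n m} {S T U : VSubset n m} → S ⊆ T → T ⊆ U → S ⊆ U
⊆-trans S⊆T T⊆U v = T⊆U v ∘ S⊆T v

⊆-∩ : ∀ {n m} {S T : VSubset n m} → T ⊆ S → T ≗ S ∩ T
⊆-∩ {S = S} {T} T⊆S v with T v in Tv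
... | true  rewrite T⊆S v Tv = refl
... | false with S v
...   | true  = refl
...   | false = refl

Minimal : ∀ {n m} → (VSubset n m → Set) → VSubset n m → Set
Minimal D S = D S × (∀ {T} → T ⊆ S → D T → S ⊆ T)

abstract
  -- Descent on the size, with `bound` as the measure. Candidates are taken in the form `S ∩ T`,
  -- which makes every one of them a subset of `S`.
  minimalSubset : ∀ {n m} {D : VSubset n m → Set} → Respects-≗ D → (∀ S → Dec (D S)) →
    ∀ S → D S → ∃ λ T → T ⊆ S × Minimal D T
  minimalSubset {D = D} resp D? S₀ d₀ = search (size S₀) S₀ ≤-refl d₀
    where
    search : ∀ bound S → size S ≤ bound → D S → ∃ λ T → T ⊆ S × Minimal D T
    search bound S S≤ d with anySubset? {D = λ T → D (S ∩ T) × size (S ∩ T) < size S}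
        (λ eq (dT , lt) → let eq′ = λ v → cong (S v ∧_) (eq v) in
                          resp eq′ dT , subst (_< size S) (size-cong eq′) lt)
        (λ T → D? (S ∩ T) ×-dec size (S ∩ T) <? size S)
    search zero        S S≤ d | yes (T , dT , lt) = contradiction (<-≤-trans lt S≤) λ ()
    search (suc bound) S S≤ d | yes (T , dT , lt) =
      let U , U⊆ , min = search bound (S ∩ T) (s≤s⁻¹ (≤-trans lt S≤)) dT
      in U , ⊆-trans U⊆ (∩-⊆ˡ S T) , min
    search bound S S≤ d | no none = S , (λ _ eq → eq) , d , λ {T} T⊆S dT v Sv →
      case T v ≟ᵇ true of λ where
        (yes Tv) → Tv
        (no ¬Tv) → contradiction
          (T , resp (⊆-∩ T⊆S) dT ,
           subst (_< size S) (size-cong (⊆-∩ T⊆S)) (size-< T⊆S v (¬-not ¬Tv) Sv))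
          none

-- Switching

switch : ∀ {n m} → BipGraph n m → Fin n → Fin m → Fin n → Fin m → BipGraph n m
switch G u v x y i j with i ≟ u | i ≟ x | j ≟ v | j ≟ y
... | yes _ | _     | yes _ | _     = false
... | yes _ | _     | no _  | yes _ = true
... | no _  | yes _ | yes _ | _     = true
... | no _  | yes _ | no _  | yes _ = false
... | _     | _     | _     | _     = G i j

module Switching {n m} (G : BipGraph n m) {u x : Fin n} {v y : Fin m}
  (Guv : G u v ≡ true) (Gxy : G x y ≡ true) (Guy : G u y ≡ false) (Gxv : G x v ≡ false) where

  G′ : BipGraph n m
  G′ = switch G u v x y

  u≢x : u ≢ x
  u≢x refl = case trans (sym Guv) Gxv of λ ()

  v≢y : v ≢ y
  v≢y refl = case trans (sym Guv) Guy of λ ()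

  -- The change of the adjacency matrix, with the removed edges on the left and the added ones on
  -- the right so that no subtraction occurs.
  balance : ∀ i j →
    b2n (G′ i j) + (δ u i * δ v j + δ x i * δ y j) ≡ b2n (G i j) + (δ u i * δ y j + δ x i * δ v j)
  balance i j with i ≟ u | i ≟ x | j ≟ v | j ≟ y
  ... | yes refl | yes refl | _ | _ = contradiction refl u≢x
  ... | _ | _ | yes refl | yes refl = contradiction refl v≢y
  ... | yes refl | no i≢x | yes refl | no j≢y
    rewrite Guv | δ-≡ i | δ-≡ j | δ-≢ (i≢x ∘ sym) | δ-≢ (j≢y ∘ sym) = refl
  ... | yes refl | no i≢x | no j≢v | yes refl
    rewrite Guy | δ-≡ i | δ-≡ j | δ-≢ (i≢x ∘ sym) | δ-≢ (j≢v ∘ sym) = refl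
  ... | yes refl | no i≢x | no j≢v | no j≢y
    rewrite δ-≡ i | δ-≢ (i≢x ∘ sym) | δ-≢ (j≢v ∘ sym) | δ-≢ (j≢y ∘ sym) = refl
  ... | no i≢u | yes refl | yes refl | no j≢y
    rewrite Gxv | δ-≡ i | δ-≡ j | δ-≢ (i≢u ∘ sym) | δ-≢ (j≢y ∘ sym) = refl
  ... | no i≢u | yes refl | no j≢v | yes refl
    rewrite Gxy | δ-≡ i | δ-≡ j | δ-≢ (i≢u ∘ sym) | δ-≢ (j≢v ∘ sym) = refl
  ... | no i≢u | yes refl | no j≢v | no j≢y
    rewrite δ-≡ i | δ-≢ (i≢u ∘ sym) | δ-≢ (j≢v ∘ sym) | δ-≢ (j≢y ∘ sym) = refl
  ... | no i≢u | no i≢x | yes _ | no _  rewrite δ-≢ (i≢u ∘ sym) | δ-≢ (i≢x ∘ sym) = refl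
  ... | no i≢u | no i≢x | no _  | yes _ rewrite δ-≢ (i≢u ∘ sym) | δ-≢ (i≢x ∘ sym) = refl
  ... | no i≢u | no i≢x | no _  | no _  rewrite δ-≢ (i≢u ∘ sym) | δ-≢ (i≢x ∘ sym) = refl

  edgeSum-switch : ∀ (f : Fin n → Fin m → ℕ) →
    edgeSum G′ f + (f u v + f x y) ≡ edgeSum G f + (f u y + f x v)
  edgeSum-switch f = begin
    edgeSum G′ f + (f u v + f x y)
      ≡⟨ expand G′ v y ⟨
    (sumF λ i → sumF λ j → (b2n (G′ i j) + (δ u i * δ v j + δ x i * δ y j)) * f i j)
      ≡⟨ (sumF-cong λ i → sumF-cong λ j → cong (_* f i j) (balance i j)) ⟩
    (sumF λ i → sumF λ j → (b2n (G i j) + (δ u i * δ y j + δ x i * δ v j)) * f i j)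
      ≡⟨ expand G y v ⟩
    edgeSum G f + (f u y + f x v) ∎
    where
    open ≡-Reasoning
    expand : ∀ (H : BipGraph n m) p q →
      (sumF λ i → sumF λ j → (b2n (H i j) + (δ u i * δ p j + δ x i * δ q j)) * f i j) ≡
      edgeSum H f + (f u p + f x q)
    expand H p q = begin
      (sumF λ i → sumF λ j → (b2n (H i j) + (δ u i * δ p j + δ x i * δ q j)) * f i j)
        ≡⟨ (sumF-cong λ i → sumF-cong λ j →
             distrib (b2n (H i j)) (δ u i * δ p j) (δ x i * δ q j) (f i j)) ⟩
      (sumF λ i → sumF λ j → b2n (H i j) * f i j + (δ u i * δ p j * f i j + δ x i * δ q j * f i j))
        ≡⟨ sum₂-+ (λ i j → b2n (H i j) * f i j) (λ i j → δ u i * δ p j * f i j + δ x i * δ q j * f i j) ⟩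
      edgeSum H f + (sumF λ i → sumF λ j → δ u i * δ p j * f i j + δ x i * δ q j * f i j)
        ≡⟨ cong (edgeSum H f +_) (sum₂-+ (λ i j → δ u i * δ p j * f i j) (λ i j → δ x i * δ q j * f i j)) ⟩
      edgeSum H f + ((sumF λ i → sumF λ j → δ u i * δ p j * f i j) + (sumF λ i → sumF λ j → δ x i * δ q j * f i j))
        ≡⟨ cong (edgeSum H f +_) (cong₂ _+_ (sum₂-δ u p f) (sum₂-δ x q f)) ⟩
      edgeSum H f + (f u p + f x q) ∎
      where
      distrib : ∀ a b c d → (a + (b + c)) * d ≡ a * d + (b * d + c * d)
      distrib = solve 4 (λ a b c d → (a :+ (b :+ c)) :* d := a :* d :+ (b :* d :+ c :* d)) refl
        where open +-*-Solver

  degX-switch : ∀ i → degX G′ i ≡ degX G i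
  degX-switch i = trans (degX≡edgeSum G′ i) (trans
    -- The weight depends on the row only, so the removed and the added edges carry the same total,
    -- which cancels.
    (+-cancelʳ-≡ (δ i u + δ i x) _ _ (edgeSum-switch (λ i′ _ → δ i i′)))
    (sym (degX≡edgeSum G i)))

  degY-switch : ∀ j → degY G′ j ≡ degY G j
  degY-switch j = trans (degY≡edgeSum G′ j) (trans
    (+-cancelʳ-≡ (δ j v + δ j y) _ _
      (trans (edgeSum-switch (λ _ j′ → δ j j′)) (cong (edgeSum G (λ _ j′ → δ j j′) +_) (+-comm (δ j y) (δ j v)))))
    (sym (degY≡edgeSum G j)))

-- Neighbours inside a set

nbrs : ∀ {n m} → BipGraph n m → VSubset n m → Vertex n m → ℕ
nbrs G P (inj₁ i) = sumF λ j → b2n (G i j) * b2n (P (inj₂ j))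
nbrs G P (inj₂ j) = sumF λ i → b2n (G i j) * b2n (P (inj₁ i))

deg : ∀ {n m} → BipGraph n m → Vertex n m → ℕ
deg G = nbrs G (λ _ → true)

deg≡degX : ∀ {n m} (G : BipGraph n m) i → deg G (inj₁ i) ≡ degX G i
deg≡degX G i = trans (sumF-cong λ j → *-identityʳ (b2n (G i j))) (sym (count≡sumF (G i)))

deg≡degY : ∀ {n m} (G : BipGraph n m) j → deg G (inj₂ j) ≡ degY G j
deg≡degY G j = trans (sumF-cong λ i → *-identityʳ (b2n (G i j))) (sym (count≡sumF (λ i → G i j)))

nbrs-∁ : ∀ {n m} (G : BipGraph n m) P v → nbrs G P v + nbrs G (∁ P) v ≡ deg G v
nbrs-∁ G P = λ where
    (inj₁ i) → trans (sym (sumF-+ (λ j → b2n (G i j) * b2n (P (inj₂ j))) (λ j → b2n (G i j) * b2n (∁ P (inj₂ j)))))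
                     (sumF-cong λ j → pointwise (G i j) (P (inj₂ j)))
    (inj₂ j) → trans (sym (sumF-+ (λ i → b2n (G i j) * b2n (P (inj₁ i))) (λ i → b2n (G i j) * b2n (∁ P (inj₁ i)))))
                     (sumF-cong λ i → pointwise (G i j) (P (inj₁ i)))
  where
  pointwise : ∀ g p → b2n g * b2n p + b2n g * b2n (not p) ≡ b2n g * 1
  pointwise = toWitness {a? = ∀ᵇ? λ g → ∀ᵇ? λ p → _ ≟ℕ _} _

-- Double counting: an edge contributes the weight of each end whose opposite end lies in `P`.
sumV-nbrs : ∀ {n m} (G : BipGraph n m) (α : Vertex n m → ℕ) P →
  sumV (λ v → α v * nbrs G P v) ≡
  edgeSum G (λ i j → α (inj₁ i) * b2n (P (inj₂ j)) + α (inj₂ j) * b2n (P (inj₁ i)))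
sumV-nbrs G α P = sym (trans (edgeSum-+ G _ _) (cong₂ _+_ rows cols))
  where
  rows : edgeSum G (λ i j → α (inj₁ i) * b2n (P (inj₂ j))) ≡ sumF (λ i → α (inj₁ i) * nbrs G P (inj₁ i))
  rows = sumF-cong λ i → trans
    (sumF-cong λ j → *-swap (b2n (G i j)) (α (inj₁ i)) (b2n (P (inj₂ j))))
    (sumF-*ˡ (α (inj₁ i)) (λ j → b2n (G i j) * b2n (P (inj₂ j))))
  cols : edgeSum G (λ i j → α (inj₂ j) * b2n (P (inj₁ i))) ≡ sumF (λ j → α (inj₂ j) * nbrs G P (inj₂ j))
  cols = trans (sumF-swap (λ i j → b2n (G i j) * (α (inj₂ j) * b2n (P (inj₁ i))))) (sumF-cong λ j → trans
    (sumF-cong λ i → *-swap (b2n (G i j)) (α (inj₂ j)) (b2n (P (inj₁ i))))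
    (sumF-*ˡ (α (inj₂ j)) (λ i → b2n (G i j) * b2n (P (inj₁ i)))))

HasEdge : ∀ {n m} → BipGraph n m → VSubset n m → Set
HasEdge G A = ∃ λ i → ∃ λ j → G i j ≡ true × A (inj₁ i) ≡ true × A (inj₂ j) ≡ true

hasEdge? : ∀ {n m} (G : BipGraph n m) A → Dec (HasEdge G A)
hasEdge? G A = any? λ i → any? λ j → G i j ≟ᵇ true ×-dec A (inj₁ i) ≟ᵇ true ×-dec A (inj₂ j) ≟ᵇ true

-- With no edge inside `P` joining two vertices on side `s` of `S`, all neighbours of `w` in `P` lie
-- on the other side, so `S` splits every edge from `w` into `P`.
nbrs≤split : ∀ {n m} (G : BipGraph n m) P S s →
  (∀ i j → G i j ≡ true → P (inj₁ i) ≡ true → P (inj₂ j) ≡ true → S (inj₁ i) ≡ s → S (inj₂ j) ≡ s → ⊥) →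
  ∀ w → P w ≡ true → S w ≡ s → nbrs G P w ≤ split G P S
nbrs≤split G P S s noEdge = λ where
    (inj₁ i) Pi Si → ≤-trans
      (sumF-mono λ j → b2n-*-mono (G i j) λ Gij → pointwise (P (inj₁ i)) (P (inj₂ j)) (S (inj₁ i)) (S (inj₂ j)) s
        Pi Si λ Pj Sj → noEdge i j Gij Pi Pj Si Sj)
      (term≤sumF (λ i → sumF λ j → weight i j) i)
    (inj₂ j) Pj Sj → ≤-trans
      (sumF-mono λ i → b2n-*-mono (G i j) λ Gij → ≤-trans (pointwise (P (inj₂ j)) (P (inj₁ i)) (S (inj₂ j)) (S (inj₁ i)) s
        Pj Sj λ Pi Si → noEdge i j Gij Pi Pj Si Sj)
        (≤-reflexive (symmetric (P (inj₁ i)) (P (inj₂ j)) (S (inj₁ i)) (S (inj₂ j)))))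
      (≤-trans (term≤sumF (λ j → sumF λ i → weight i j) j) (≤-reflexive (sym (sumF-swap weight))))
  where
  weight : _ → _ → ℕ
  weight i j = b2n (G i j) * b2n (P (inj₁ i) ∧ P (inj₂ j) ∧ (S (inj₁ i) xor S (inj₂ j)))
  symmetric : ∀ p p′ s s′ → b2n (p′ ∧ p ∧ (s′ xor s)) ≡ b2n (p ∧ p′ ∧ (s xor s′))
  symmetric = toWitness {a? = ∀ᵇ? λ _ → ∀ᵇ? λ _ → ∀ᵇ? λ _ → ∀ᵇ? λ _ → _ ≟ℕ _} _
  pointwise : ∀ p p′ s s′ t → p ≡ true → s ≡ t → (p′ ≡ true → s′ ≡ t → ⊥) →
    b2n p′ ≤ b2n (p ∧ p′ ∧ (s xor s′))
  pointwise = toWitness {a? = ∀ᵇ? λ _ → ∀ᵇ? λ _ → ∀ᵇ? λ _ → ∀ᵇ? λ _ → ∀ᵇ? λ _ →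
    _ ≟ᵇ _ →-dec _ ≟ᵇ _ →-dec (_ ≟ᵇ _ →-dec _ ≟ᵇ _ →-dec no λ ()) →-dec _ ≤? _} _

b2n≤1 : ∀ b → b2n b ≤ 1
b2n≤1 false = z≤n
b2n≤1 true  = ≤-refl

b2n-true : ∀ {b} → b ≡ true → 1 ≤ b2n b
b2n-true refl = ≤-refl

-- If every edge from i into Q ended at a vertex with a neighbour outside Q, the columns
-- of these edges together with the edges leaving Q at i would give at least deg i cut edges.
internalNbrX : ∀ {n m} (G : BipGraph n m) Q i → Q (inj₁ i) ≡ true → cut G Q < deg G (inj₁ i) →
  ∃ λ j → G i j ≡ true × Q (inj₂ j) ≡ true × (∀ i′ → G i′ j ≡ true → Q (inj₁ i′) ≡ true)
internalNbrX G Q i Qi cut<deg with any? (λ j → G i j ≟ᵇ true ×-dec Q (inj₂ j) ≟ᵇ true ×-dec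
  all? λ i′ → G i′ j ≟ᵇ true →-dec Q (inj₁ i′) ≟ᵇ true)
... | yes found = found
... | no none = contradiction cut<deg (≤⇒≯ (≤-trans (sumF-mono column) (≤-reflexive (sym (sumF-swap weight)))))
  where
  weight : _ → _ → ℕ
  weight i j = b2n (G i j) * b2n (Q (inj₁ i) xor Q (inj₂ j))
  column : ∀ j → b2n (G i j) * 1 ≤ sumF λ i′ → weight i′ j
  column j with G i j in Gij | Q (inj₂ j) in Qj
  ... | false | _     = z≤n
  ... | true  | false = ≤-trans (≤-reflexive (sym eq)) (term≤sumF (λ i′ → b2n (G i′ j) * b2n (Q (inj₁ i′) xor false)) i)
    where
    eq : b2n (G i j) * b2n (Q (inj₁ i) xor false) ≡ 1
    eq rewrite Gij | Qi = refl
  ... | true  | true with any? (λ i′ → G i′ j ≟ᵇ true ×-dec Q (inj₁ i′) ≟ᵇ false)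
  ...   | no ¬out = contradiction
    (j , Gij , Qj , λ i′ Gi′j → ¬-not λ Qi′ → ¬out (i′ , Gi′j , Qi′)) none
  ...   | yes (i′ , Gi′j , Qi′) =
    ≤-trans (≤-reflexive (sym eq)) (term≤sumF (λ i′ → b2n (G i′ j) * b2n (Q (inj₁ i′) xor true)) i′)
    where
    eq : b2n (G i′ j) * b2n (Q (inj₁ i′) xor true) ≡ 1
    eq rewrite Gi′j | Qi′ = refl

-- The argument of `internalNbrX` with the parts exchanged; `cut` already sums over rows first, so
-- the order of summation stays.
internalNbrY : ∀ {n m} (G : BipGraph n m) Q j → Q (inj₂ j) ≡ true → cut G Q < deg G (inj₂ j) →
  ∃ λ i → G i j ≡ true × Q (inj₁ i) ≡ true × (∀ j′ → G i j′ ≡ true → Q (inj₂ j′) ≡ true)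
internalNbrY G Q j Qj cut<deg with any? (λ i → G i j ≟ᵇ true ×-dec Q (inj₁ i) ≟ᵇ true ×-dec
  all? λ j′ → G i j′ ≟ᵇ true →-dec Q (inj₂ j′) ≟ᵇ true)
... | yes found = found
... | no none = contradiction cut<deg (≤⇒≯ (sumF-mono row))
  where
  row : ∀ i → b2n (G i j) * 1 ≤ sumF λ j′ → b2n (G i j′) * b2n (Q (inj₁ i) xor Q (inj₂ j′))
  row i with G i j in Gij | Q (inj₁ i) in Qi
  ... | false | _     = z≤n
  ... | true  | false = ≤-trans (≤-reflexive (sym eq)) (term≤sumF (λ j′ → b2n (G i j′) * b2n (Q (inj₂ j′))) j)
    where
    eq : b2n (G i j) * b2n (Q (inj₂ j)) ≡ 1
    eq rewrite Gij | Qj = refl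
  ... | true  | true with any? (λ j′ → G i j′ ≟ᵇ true ×-dec Q (inj₂ j′) ≟ᵇ false)
  ...   | no ¬out = contradiction
    (i , Gij , Qi , λ j′ Gij′ → ¬-not λ Qj′ → ¬out (j′ , Gij′ , Qj′)) none
  ...   | yes (j′ , Gij′ , Qj′) =
    ≤-trans (≤-reflexive (sym eq)) (term≤sumF (λ j′ → b2n (G i j′) * b2n (not (Q (inj₂ j′)))) j′)
    where
    eq : b2n (G i j′) * b2n (not (Q (inj₂ j′))) ≡ 1
    eq rewrite Gij′ | Qj′ = refl

abstract
  -- The first application finds a vertex with all neighbours in `Q`; the second, started there,
  -- finds a neighbour of it with the same property. This property later ensures that the edges to
  -- be added are not yet present.
  internalEdge : ∀ {n m} (G : BipGraph n m) Q → Nonempty Q → (∀ v → cut G Q < deg G v) →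
    ∃ λ x → ∃ λ y → G x y ≡ true × Q (inj₁ x) ≡ true × Q (inj₂ y) ≡ true ×
      (∀ j → G x j ≡ true → Q (inj₂ j) ≡ true) × (∀ i → G i y ≡ true → Q (inj₁ i) ≡ true)
  internalEdge G Q (inj₁ i , Qi) cut<deg =
    let y , _ , Qy , y-int   = internalNbrX G Q i Qi (cut<deg (inj₁ i))
        x , Gxy , Qx , x-int = internalNbrY G Q y Qy (cut<deg (inj₂ y))
    in x , y , Gxy , Qx , Qy , x-int , y-int
  internalEdge G Q (inj₂ j , Qj) cut<deg =
    let x , _ , Qx , x-int   = internalNbrY G Q j Qj (cut<deg (inj₂ j))
        y , Gxy , Qy , y-int = internalNbrX G Q x Qx (cut<deg (inj₁ x))
    in x , y , Gxy , Qx , Qy , x-int , y-int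

-- The two edges to be switched

does-true : ∀ {X : Set} (X? : Dec X) → does X? ≡ true → X
does-true (yes x) _ = x

does-false : ∀ {X : Set} (X? : Dec X) → not (does X?) ≡ true → ¬ X
does-false (no ¬x) _ = ¬x

-- At least `(k + 3) / 2` neighbours in `P`, the bound that `good⇒split` has to reach.
Good : ∀ {n m} → BipGraph n m → ℕ → VSubset n m → Vertex n m → Set
Good G k P v = 3 + k ≤ 2 * nbrs G P v

Good? : ∀ {n m} (G : BipGraph n m) k P v → Dec (Good G k P v)
Good? G k P v = 3 + k ≤? 2 * nbrs G P v

-- Here `p` and `q` count the neighbours of a vertex inside and outside `P`. If it is not good, then
-- `2p ≤ k + 2 ≤ μ + 1 ≤ p + q + 1`, so `p ≤ q + 1`. This is at most `2q` unless `q = 0`, and then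
-- `μ ≤ 1`.
bad⇒nbrs≤ : ∀ {μ k p q} → 3 ≤ μ → k < μ → μ ≤ p + q → ¬ 3 + k ≤ 2 * p → p ≤ 2 * q
bad⇒nbrs≤ {μ} {k} {p} {q} 3≤μ k<μ μ≤p+q bad = bound q p≤1+q μ≤p+q
  where
  p≤1+q : p ≤ 1 + q
  p≤1+q = +-cancelˡ-≤ p p (1 + q) (begin
    p + p        ≡⟨ cong (p +_) (+-identityʳ p) ⟨
    2 * p        ≤⟨ s≤s⁻¹ (≰⇒> bad) ⟩
    2 + k        ≤⟨ s≤s k<μ ⟩
    1 + μ        ≤⟨ s≤s μ≤p+q ⟩
    1 + (p + q)  ≡⟨ +-suc p q ⟨
    p + (1 + q)  ∎)
    where open ≤-Reasoning
  bound : ∀ q → p ≤ 1 + q → μ ≤ p + q → p ≤ 2 * q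
  bound zero    p≤ μ≤ = contradiction (≤-trans 3≤μ (≤-trans μ≤ (+-monoˡ-≤ 0 p≤))) λ { (s≤s ()) }
  bound (suc q) p≤ μ≤ = ≤-trans p≤ (s≤s (≤-trans (m≤n+m (1 + q) q) (≤-reflexive (cong (q +_) (sym (+-identityʳ (suc q)))))))

-- Here `a` and `b` are the sizes of the two sides of a set and `e` is its number of edges. If
-- `a + b ≥ 5`, the degree sum is at least `5(k + 1)` but at most `5k + 1`. Otherwise `e ≤ ab` and
-- `k + 1 ≤ μ` give `3(a + b - 1) ≤ 2ab`, which fails in each case, most narrowly for `a = b = 2`
-- with 9 against 8.
tooFewEdges : ∀ {μ k a b e} → 3 ≤ μ → k < μ → 1 ≤ a → 1 ≤ b →
  e ≤ 2 * k → e ≤ a * b → μ * (a + b) ≤ 2 * e + suc k → ⊥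
tooFewEdges {μ} {k} {a} {b} {e} 3≤μ k<μ 1≤a 1≤b e≤2k e≤ab degrees with a + b ≤? 4
... | no ¬small = <⇒≱ (≤-trans (s≤s (m≤n+m _ 3)) (≤-reflexive (expand k))) (begin
    5 * suc k          ≤⟨ *-mono-≤ (≰⇒> ¬small) k<μ ⟩
    (a + b) * μ        ≡⟨ *-comm (a + b) μ ⟩
    μ * (a + b)        ≤⟨ degrees ⟩
    2 * e + suc k      ≤⟨ +-monoˡ-≤ (suc k) (*-monoʳ-≤ 2 e≤2k) ⟩
    2 * (2 * k) + suc k ∎)
  where
  open ≤-Reasoning
  expand : ∀ k → 4 + (2 * (2 * k) + suc k) ≡ 5 * suc k
  expand = solve 1 (λ k → con 4 :+ (con 2 :* (con 2 :* k) :+ (con 1 :+ k)) := con 5 :* (con 1 :+ k)) refl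
    where open +-*-Solver
... | yes small = cases 1≤a 1≤b small (begin
    3 * (a + b ∸ 1)    ≤⟨ *-monoˡ-≤ (a + b ∸ 1) 3≤μ ⟩
    μ * (a + b ∸ 1)    ≡⟨ trans (*-distribˡ-∸ μ (a + b) 1) (cong (μ * (a + b) ∸_) (*-identityʳ μ)) ⟩
    μ * (a + b) ∸ μ    ≤⟨ ∸-monoˡ-≤ μ (≤-trans degrees (+-mono-≤ (*-monoʳ-≤ 2 e≤ab) k<μ)) ⟩
    2 * (a * b) + μ ∸ μ ≡⟨ m+n∸n≡m (2 * (a * b)) μ ⟩
    2 * (a * b)        ∎)
  where
  open ≤-Reasoning
  cases : ∀ {a b} → 1 ≤ a → 1 ≤ b → a + b ≤ 4 → ¬ 3 * (a + b ∸ 1) ≤ 2 * (a * b)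
  cases {1} {1} _ _ _ = toWitnessFalse {a? = _ ≤? _} _
  cases {1} {2} _ _ _ = toWitnessFalse {a? = _ ≤? _} _
  cases {1} {3} _ _ _ = toWitnessFalse {a? = _ ≤? _} _
  cases {2} {1} _ _ _ = toWitnessFalse {a? = _ ≤? _} _
  cases {2} {2} _ _ _ = toWitnessFalse {a? = _ ≤? _} _
  cases {3} {1} _ _ _ = toWitnessFalse {a? = _ ≤? _} _
  cases {1} {suc (suc (suc (suc b)))} _ _ (s≤s (s≤s (s≤s (s≤s ()))))
  cases {2} {suc (suc (suc b))} _ _ (s≤s (s≤s (s≤s (s≤s ()))))
  cases {3} {suc (suc b)} _ _ (s≤s (s≤s (s≤s (s≤s ()))))
  cases {suc (suc (suc (suc a)))} {suc b} _ _ (s≤s (s≤s (s≤s (s≤s le)))) =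
    contradiction (≤-trans (≤-reflexive (sym (+-suc a b))) le) λ ()

b2n-*-≤ : ∀ b {x y} → (b ≡ true → x ≤ y) → ∀ c → (b ≡ true → c ≡ true) → b2n b * x ≤ b2n c * y
b2n-*-≤ false h c b⇒c = z≤n
b2n-*-≤ true  h c b⇒c rewrite b⇒c refl = +-mono-≤ (h refl) z≤n

-- A vertex of P that is not good sends so many edges out of P that such vertices cover at
-- most 2k edges; but A contains more edges than that.
abstract
  goodEdge : ∀ {n m μ k} (G : BipGraph n m) → 3 ≤ μ → k < μ → (∀ v → μ ≤ deg G v) →
    ∀ {P A} → cut G P ≤ k → A ⊆ P → cut G A ≤ suc k → HasEdge G A →
    ∃ λ u → ∃ λ v → G u v ≡ true × A (inj₁ u) ≡ true × A (inj₂ v) ≡ true ×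
      Good G k P (inj₁ u) × Good G k P (inj₂ v)
  goodEdge {n} {m} {μ} {k} G 3≤μ k<μ μ≤deg {P} {A} cutP≤k A⊆P cutA≤k+1 (i₀ , j₀ , _ , Ai₀ , Aj₀)
    with any? (λ u → any? λ v → G u v ≟ᵇ true ×-dec A (inj₁ u) ≟ᵇ true ×-dec A (inj₂ v) ≟ᵇ true ×-dec
               Good? G k P (inj₁ u) ×-dec Good? G k P (inj₂ v))
  ... | yes found = found
  ... | no none = ⊥-elim (tooFewEdges 3≤μ k<μ
      (≤-trans (b2n-true Ai₀) (term≤sumF (λ i → b2n (A (inj₁ i))) i₀))
      (≤-trans (b2n-true Aj₀) (term≤sumF (λ j → b2n (A (inj₂ j))) j₀))
      e≤2k e≤ab degrees)
    where
    good? : ∀ v → Dec (Good G k P v)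
    good? = Good? G k P
    e a b : ℕ
    e = edgeSum G λ i j → b2n (A (inj₁ i) ∧ A (inj₂ j))
    a = sumF λ i → b2n (A (inj₁ i))
    b = sumF λ j → b2n (A (inj₂ j))
    bad : VSubset n m
    bad v = A v ∧ not (does (good? v))
    good : ∀ v → does (good? v) ≡ true → Good G k P v
    good v = does-true (good? v)
    covered : ∀ a a′ g g′ p p′ → (a ≡ true → p ≡ true) → (a′ ≡ true → p′ ≡ true) →
      ¬ (a ≡ true × a′ ≡ true × g ≡ true × g′ ≡ true) →
      b2n (a ∧ a′) ≤ b2n (a ∧ not g) * b2n p′ + b2n (a′ ∧ not g′) * b2n p
    covered = toWitness {a? = ∀ᵇ? λ _ → ∀ᵇ? λ _ → ∀ᵇ? λ _ → ∀ᵇ? λ _ → ∀ᵇ? λ _ → ∀ᵇ? λ _ →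
      (_ ≟ᵇ _ →-dec _ ≟ᵇ _) →-dec (_ ≟ᵇ _ →-dec _ ≟ᵇ _) →-dec
      ¬? (_ ≟ᵇ _ ×-dec _ ≟ᵇ _ ×-dec _ ≟ᵇ _ ×-dec _ ≟ᵇ _) →-dec _ ≤? _} _
    leaving : ∀ p p′ → 2 * b2n p * b2n (not p′) + 2 * b2n p′ * b2n (not p) ≡ 2 * b2n (p xor p′)
    leaving = toWitness {a? = ∀ᵇ? λ _ → ∀ᵇ? λ _ → _ ≟ℕ _} _
    ends : ∀ a a′ → b2n a * 1 + b2n a′ * 1 ≡ 2 * b2n (a ∧ a′) + b2n (a xor a′)
    ends = toWitness {a? = ∀ᵇ? λ _ → ∀ᵇ? λ _ → _ ≟ℕ _} _
    within : ∀ g a a′ → b2n g * b2n (a ∧ a′) ≤ b2n a * b2n a′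
    within = toWitness {a? = ∀ᵇ? λ _ → ∀ᵇ? λ _ → ∀ᵇ? λ _ → _ ≤? _} _
    open ≤-Reasoning
    -- Each edge inside `A` is charged to a bad end. A bad vertex has at most twice as many
    -- neighbours inside `P` as outside, and summing outside neighbours over `P` counts each edge of
    -- its cut once.
    e≤2k : e ≤ 2 * k
    e≤2k = begin
      e ≤⟨ edgeSum-mono G (λ i j Gij → covered (A (inj₁ i)) (A (inj₂ j)) (does (good? (inj₁ i)))
             (does (good? (inj₂ j))) (P (inj₁ i)) (P (inj₂ j)) (A⊆P (inj₁ i)) (A⊆P (inj₂ j))
             λ (Ai , Aj , gi , gj) → none (i , j , Gij , Ai , Aj , good (inj₁ i) gi , good (inj₂ j) gj)) ⟩
      edgeSum G (λ i j → b2n (bad (inj₁ i)) * b2n (P (inj₂ j)) + b2n (bad (inj₂ j)) * b2n (P (inj₁ i)))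
        ≡⟨ sumV-nbrs G (b2n ∘ bad) P ⟨
      sumV (λ v → b2n (bad v) * nbrs G P v)
        ≤⟨ sumV-mono (λ v → b2n-*-≤ (bad v) (few v) (P v) λ eq → A⊆P v (proj₁ (∧-true eq))) ⟩
      sumV (λ v → b2n (P v) * (2 * nbrs G (∁ P) v))
        ≡⟨ sumV-cong (λ v → assoc (b2n (P v)) (nbrs G (∁ P) v)) ⟩
      sumV (λ v → 2 * b2n (P v) * nbrs G (∁ P) v)
        ≡⟨ sumV-nbrs G (λ v → 2 * b2n (P v)) (∁ P) ⟩
      edgeSum G (λ i j → 2 * b2n (P (inj₁ i)) * b2n (not (P (inj₂ j))) + 2 * b2n (P (inj₂ j)) * b2n (not (P (inj₁ i))))
        ≡⟨ edgeSum-cong G (λ i j → leaving (P (inj₁ i)) (P (inj₂ j))) ⟩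
      edgeSum G (λ i j → 2 * b2n (P (inj₁ i) xor P (inj₂ j)))
        ≡⟨ edgeSum-*ˡ G 2 (λ i j → b2n (P (inj₁ i) xor P (inj₂ j))) ⟩
      2 * cut G P ≤⟨ *-monoʳ-≤ 2 cutP≤k ⟩
      2 * k ∎
      where
      assoc : ∀ x y → x * (2 * y) ≡ 2 * x * y
      assoc = solve 2 (λ x y → x :* (con 2 :* y) := con 2 :* x :* y) refl where open +-*-Solver
      few : ∀ v → bad v ≡ true → nbrs G P v ≤ 2 * nbrs G (∁ P) v
      few v eq = bad⇒nbrs≤ 3≤μ k<μ (≤-trans (μ≤deg v) (≤-reflexive (sym (nbrs-∁ G P v))))
        (does-false (good? v) (proj₂ (∧-true {A v} eq)))
    e≤ab : e ≤ a * b
    e≤ab = begin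
      e ≤⟨ sumF-mono (λ i → sumF-mono λ j → within (G i j) (A (inj₁ i)) (A (inj₂ j))) ⟩
      (sumF λ i → sumF λ j → b2n (A (inj₁ i)) * b2n (A (inj₂ j)))
        ≡⟨ sumF-cong (λ i → trans (sumF-*ˡ (b2n (A (inj₁ i))) (λ j → b2n (A (inj₂ j)))) (*-comm (b2n (A (inj₁ i))) b)) ⟩
      (sumF λ i → b * b2n (A (inj₁ i))) ≡⟨ sumF-*ˡ b (λ i → b2n (A (inj₁ i))) ⟩
      b * a ≡⟨ *-comm b a ⟩
      a * b ∎
    -- Handshake: an edge inside `A` is seen from both ends, an edge of its cut from one.
    degrees : μ * (a + b) ≤ 2 * e + suc k
    degrees = begin
      μ * (a + b) ≡⟨ *-distribˡ-+ μ a b ⟩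
      μ * a + μ * b ≡⟨ cong₂ _+_ (sumF-*ˡ μ (λ i → b2n (A (inj₁ i)))) (sumF-*ˡ μ (λ j → b2n (A (inj₂ j)))) ⟨
      sumV (λ v → μ * b2n (A v))
        ≤⟨ sumV-mono (λ v → ≤-trans (≤-reflexive (*-comm μ (b2n (A v)))) (*-monoʳ-≤ (b2n (A v)) (μ≤deg v))) ⟩
      sumV (λ v → b2n (A v) * deg G v)
        ≡⟨ sumV-nbrs G (b2n ∘ A) (λ _ → true) ⟩
      edgeSum G (λ i j → b2n (A (inj₁ i)) * 1 + b2n (A (inj₂ j)) * 1)
        ≡⟨ edgeSum-cong G (λ i j → ends (A (inj₁ i)) (A (inj₂ j))) ⟩
      edgeSum G (λ i j → 2 * b2n (A (inj₁ i) ∧ A (inj₂ j)) + b2n (A (inj₁ i) xor A (inj₂ j)))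
        ≡⟨ edgeSum-+ G (λ i j → 2 * b2n (A (inj₁ i) ∧ A (inj₂ j))) (λ i j → b2n (A (inj₁ i) xor A (inj₂ j))) ⟩
      edgeSum G (λ i j → 2 * b2n (A (inj₁ i) ∧ A (inj₂ j))) + cut G A
        ≤⟨ +-mono-≤ (≤-reflexive (edgeSum-*ˡ G 2 (λ i j → b2n (A (inj₁ i) ∧ A (inj₂ j))))) cutA≤k+1 ⟩
      2 * e + suc k ∎

-- Minimal cuts and their splittings

not-true : ∀ {b} → not b ≡ true → b ≡ false
not-true {false} _ = refl

∖-true : ∀ {n m} (S T : VSubset n m) {v} → (S ∖ T) v ≡ true → S v ≡ true × T v ≡ false
∖-true S T eq = let Sv , ¬Tv = ∧-true eq in Sv , not-true ¬Tv

true≢false : ∀ {b} → b ≡ true → b ≡ false → ⊥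
true≢false refl ()

SmallCut : ∀ {n m} → BipGraph n m → ℕ → VSubset n m → Set
SmallCut G k S = Nonempty S × cut G S ≤ k

-- Asking for an edge lets a minimal such set still supply `uv`; the bound `k + 1` is what both
-- parts of `P` meet in the critical case of `good⇒split`.
ThinWithEdge : ∀ {n m} → BipGraph n m → ℕ → VSubset n m → Set
ThinWithEdge G k S = HasEdge G S × cut G S ≤ suc k

minimalSmallCut : ∀ {n m} (G : BipGraph n m) k S → SmallCut G k S →
  ∃ λ P → P ⊆ S × Minimal (SmallCut G k) P
minimalSmallCut G k = minimalSubset
  (λ eq ((v , Sv) , le) → (v , trans (sym (eq v)) Sv) , subst (_≤ k) (cut-cong G eq) le)
  (λ S → nonempty? S ×-dec cut G S ≤? k)

minimalThin : ∀ {n m} (G : BipGraph n m) k S → ThinWithEdge G k S →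
  ∃ λ A → A ⊆ S × Minimal (ThinWithEdge G k) A
minimalThin G k = minimalSubset
  (λ eq ((i , j , Gij , Si , Sj) , le) →
    (i , j , Gij , trans (sym (eq (inj₁ i))) Si , trans (sym (eq (inj₂ j))) Sj) ,
    subst (_≤ suc k) (cut-cong G eq) le)
  (λ S → hasEdge? G S ×-dec cut G S ≤? suc k)

properSubset-cut : ∀ {n m k} (G : BipGraph n m) {P T} → Minimal (SmallCut G k) P →
  T ⊆ P → Nonempty T → ∀ w → P w ≡ true → T w ≡ false → suc k ≤ cut G T
properSubset-cut G (_ , minimal) T⊆P T≠∅ w Pw Tw =
  ≰⇒> λ small → true≢false (minimal T⊆P (T≠∅ , small) w Pw) Tw

squeeze : ∀ {a b c d} → a + b ≤ c + d → d ≤ b → a ≤ c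
squeeze {a} {b} {c} {d} le d≤b = +-cancelʳ-≤ d a c (≤-trans (+-monoʳ-≤ a d≤b) le)

module _ {n m k} (G : BipGraph n m) {P : VSubset n m} (P-min : Minimal (SmallCut G k) P)
  (S : VSubset n m) {w₁ w₂ : Vertex n m} (Pw₁ : P w₁ ≡ true) (Pw₂ : P w₂ ≡ true)
  (Sw₁ : S w₁ ≡ true) (Sw₂ : S w₂ ≡ false) where

  private
    B₁ B₂ : VSubset n m
    B₁ = P ∩ S
    B₂ = P ∖ S

    B₁w₁ : B₁ w₁ ≡ true
    B₁w₁ = cong₂ _∧_ Pw₁ Sw₁

    B₁w₂ : B₁ w₂ ≡ false
    B₁w₂ = cong₂ _∧_ Pw₂ Sw₂

    B₂w₁ : B₂ w₁ ≡ false
    B₂w₁ = cong₂ _∧_ Pw₁ (cong not Sw₁)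

    B₂w₂ : B₂ w₂ ≡ true
    B₂w₂ = cong₂ _∧_ Pw₂ (cong not Sw₂)

    k<cutB₁ : k < cut G B₁
    k<cutB₁ = properSubset-cut G P-min (λ v → proj₁ ∘ ∧-true) (w₁ , B₁w₁) w₂ Pw₂ B₁w₂

    k<cutB₂ : k < cut G B₂
    k<cutB₂ = properSubset-cut G P-min (λ v → proj₁ ∘ ∧-true) (w₂ , B₂w₂) w₁ Pw₁ B₂w₁

    cutB₁+cutB₂≤ : cut G B₁ + cut G B₂ ≤ k + 2 * split G P S
    cutB₁+cutB₂≤ = ≤-trans (≤-reflexive (cut-∩-∖ G P S)) (+-monoˡ-≤ _ (proj₂ (proj₁ P-min)))

  -- Both parts are nonempty proper subsets of the minimal set `P`, so each has cut at least
  -- `k + 1`, while their cuts sum to at most `k` plus twice the number of split edges.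
  minimal⇒split : 2 + k ≤ 2 * split G P S
  minimal⇒split = +-cancelˡ-≤ k (2 + k) _ (begin
    k + (2 + k)              ≡⟨ +-suc k (suc k) ⟩
    suc k + suc k            ≤⟨ +-mono-≤ k<cutB₁ k<cutB₂ ⟩
    cut G B₁ + cut G B₂      ≤⟨ cutB₁+cutB₂≤ ⟩
    k + 2 * split G P S      ∎)
    where open ≤-Reasoning

  -- If the bound fails, B₁ and B₂ both have cut k + 1 and k is even.  Uncrossing A with
  -- them then gives A and its two parts cut k + 1 each, which forces k + 1 to be even.
  good⇒split : ∀ {A} → A ⊆ P → Minimal (ThinWithEdge G k) A → A w₁ ≡ true → A w₂ ≡ true →
    Good G k P w₁ → Good G k P w₂ → 3 + k ≤ 2 * split G P S
  good⇒split {A} A⊆P ((_ , cutA≤) , A-min) Aw₁ Aw₂ good₁ good₂ with 3 + k ≤? 2 * split G P S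
  ... | yes large = large
  ... | no ¬large = ⊥-elim contra
    where
    split≤ : 2 * split G P S ≤ 2 + k
    split≤ = s≤s⁻¹ (≰⇒> ¬large)

    cuts≤ : cut G B₁ + cut G B₂ ≤ suc k + suc k
    cuts≤ = ≤-trans cutB₁+cutB₂≤ (≤-trans (+-monoʳ-≤ k split≤) (≤-reflexive (+-suc k (suc k))))

    cutB₁≤ : cut G B₁ ≤ suc k
    cutB₁≤ = squeeze cuts≤ k<cutB₂

    cutB₂≤ : cut G B₂ ≤ suc k
    cutB₂≤ = squeeze (≤-trans (≤-reflexive (+-comm (cut G B₂) _)) cuts≤) k<cutB₁

    -- Minimality of `A`: a proper subset with so small a cut can only fail to be thin by lacking an
    -- edge.
    edgeless : ∀ {B} → B ⊆ A → cut G B ≤ suc k → ∀ w → A w ≡ true → B w ≡ false → ¬ HasEdge G B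
    edgeless B⊆A cutB≤ w Aw Bw edge = true≢false (A-min B⊆A (edge , cutB≤) w Aw) Bw

    ⊆-of-empty : ∀ {B} → ¬ Nonempty (B ∖ A) → B ⊆ A
    ⊆-of-empty {B} empty v Bv with A v in Av
    ... | true  = refl
    ... | false = contradiction (v , cong₂ _∧_ Bv (cong not Av)) empty

    contra : ⊥
    contra with nonempty? (B₁ ∖ A) | nonempty? (B₂ ∖ A)
    -- Here `B₁` lies in `A` and misses `w₂`, so it has no edge. All neighbours of `w₁` in `P` are
    -- then across `S`, and goodness of `w₁` gives the bound.
    ... | no empty | _ = ¬large (≤-trans good₁ (*-monoʳ-≤ 2 (nbrs≤split G P S true
      (λ i j Gij Pi Pj Si Sj → edgeless (⊆-of-empty empty) cutB₁≤ w₂ Aw₂ B₁w₂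
        (i , j , Gij , cong₂ _∧_ Pi Si , cong₂ _∧_ Pj Sj)) w₁ Pw₁ Sw₁)))
    ... | yes _ | no empty = ¬large (≤-trans good₂ (*-monoʳ-≤ 2 (nbrs≤split G P S false
      (λ i j Gij Pi Pj Si Sj → edgeless (⊆-of-empty empty) cutB₂≤ w₁ Aw₁ B₂w₁
        (i , j , Gij , cong₂ _∧_ Pi (cong not Si) , cong₂ _∧_ Pj (cong not Sj))) w₂ Pw₂ Sw₂)))
    ... | yes (z , Zz) | yes (w , Ww) =
      -- Twice the splitting of `P` is `k + 2`, twice that of `A` is `k + 1`; consecutive numbers
      -- cannot both be even.
      even≢odd (split G P S) (split G A S) (trans 2split≡ (cong suc (sym 2splitA≡)))
      where
      Bz = ∖-true B₁ A Zz
      Bw = ∖-true B₂ A Ww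

      A∖B₁ : A ∖ S ≗ A ∖ B₁
      A∖B₁ v = pointwise (A v) (P v) (S v) (A⊆P v)
        where
        pointwise : ∀ a p s → (a ≡ true → p ≡ true) → a ∧ not s ≡ a ∧ not (p ∧ s)
        pointwise = toWitness {a? = ∀ᵇ? λ _ → ∀ᵇ? λ _ → ∀ᵇ? λ _ → (_ ≟ᵇ _ →-dec _ ≟ᵇ _) →-dec _ ≟ᵇ _} _

      A∖B₂ : A ∩ S ≗ A ∖ B₂
      A∖B₂ v = pointwise (A v) (P v) (S v) (A⊆P v)
        where
        pointwise : ∀ a p s → (a ≡ true → p ≡ true) → a ∧ s ≡ a ∧ not (p ∧ not s)
        pointwise = toWitness {a? = ∀ᵇ? λ _ → ∀ᵇ? λ _ → ∀ᵇ? λ _ → (_ ≟ᵇ _ →-dec _ ≟ᵇ _) →-dec _ ≟ᵇ _} _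

      -- Both differences of `A` and `B` are nonempty proper subsets of `P`, so each has cut at
      -- least `k + 1`, while posimodularity bounds the sum by `2k + 2`.
      part : ∀ B → cut G B ≤ suc k → B ⊆ P → Nonempty (B ∖ A) → ∀ v v′ →
        A v ≡ true → B v ≡ false → A v′ ≡ true → B v′ ≡ true → cut G (A ∖ B) ≡ suc k
      part B cutB≤ B⊆P B∖A≠∅ v v′ Av Bv Av′ Bv′ = ≤-antisym
        (squeeze (≤-trans (cut-posimodular G A B) (+-mono-≤ cutA≤ cutB≤))
          (properSubset-cut G P-min (λ u → B⊆P u ∘ proj₁ ∘ ∧-true) B∖A≠∅ v (A⊆P v Av)
            (cong (_∧ not (A v)) Bv)))
        (properSubset-cut G P-min (λ u → A⊆P u ∘ proj₁ ∘ ∧-true) (v , cong₂ _∧_ Av (cong not Bv))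
          v′ (A⊆P v′ Av′) (cong₂ _∧_ Av′ (cong not Bv′)))

      cutA≡ : cut G A ≡ suc k
      cutA≡ = ≤-antisym cutA≤ (properSubset-cut G P-min A⊆P (w₁ , Aw₁) z
        (proj₁ (∧-true (proj₁ Bz))) (proj₂ Bz))

      2splitA≡ : 2 * split G A S ≡ suc k
      2splitA≡ = +-cancelˡ-≡ (suc k) _ _ (begin
        suc k + 2 * split G A S      ≡⟨ cong (_+ 2 * split G A S) cutA≡ ⟨
        cut G A + 2 * split G A S    ≡⟨ cut-∩-∖ G A S ⟨
        cut G (A ∩ S) + cut G (A ∖ S) ≡⟨ cong₂ _+_ (cut-cong G A∖B₂) (cut-cong G A∖B₁) ⟩
        cut G (A ∖ B₂) + cut G (A ∖ B₁) ≡⟨ cong₂ _+_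
          (part B₂ cutB₂≤ (λ v → proj₁ ∘ ∧-true) (w , Ww) w₁ w₂ Aw₁ B₂w₁ Aw₂ B₂w₂)
          (part B₁ cutB₁≤ (λ v → proj₁ ∘ ∧-true) (z , Zz) w₂ w₁ Aw₂ B₁w₂ Aw₁ B₁w₁) ⟩
        suc k + suc k ∎)
        where open ≡-Reasoning

      2split≡ : 2 * split G P S ≡ 2 + k
      2split≡ = ≤-antisym split≤ minimal⇒split

-- Raising the connectivity

SameDegrees : ∀ {n m} → BipGraph n m → BipGraph n m → Set
SameDegrees G H = (∀ i → degX H i ≡ degX G i) × (∀ j → degY H j ≡ degY G j)

module _ {n m k} (G : BipGraph n m) {P Q A : VSubset n m}
  (P-min : Minimal (SmallCut G k) P) (Q-min : Minimal (SmallCut G k) Q) (Q⊆∁P : Q ⊆ ∁ P)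
  (A⊆P : A ⊆ P) (A-min : Minimal (ThinWithEdge G k) A)
  {u x : Fin n} {v y : Fin m} (Guv : G u v ≡ true) (Au : A (inj₁ u) ≡ true) (Av : A (inj₂ v) ≡ true)
  (good-u : Good G k P (inj₁ u)) (good-v : Good G k P (inj₂ v))
  (Gxy : G x y ≡ true) (Qx : Q (inj₁ x) ≡ true) (Qy : Q (inj₂ y) ≡ true)
  (x-int : ∀ j → G x j ≡ true → Q (inj₂ j) ≡ true) (y-int : ∀ i → G i y ≡ true → Q (inj₁ i) ≡ true) where

  private
    Pu : P (inj₁ u) ≡ true
    Pu = A⊆P _ Au

    Pv : P (inj₂ v) ≡ true
    Pv = A⊆P _ Av

    crossing : VSubset n m → Fin n → Fin m → ℕ
    crossing S i j = b2n (S (inj₁ i) xor S (inj₂ j))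

  -- All neighbours of `x` and `y` lie in `Q`, which is disjoint from `P`; hence `uy` and `xv` are
  -- not edges.
  open Switching G {u} {x} {v} {y} Guv Gxy
    (¬-not λ Guy → true≢false Pu (not-true (Q⊆∁P _ (y-int u Guy))))
    (¬-not λ Gxv → true≢false Pv (not-true (Q⊆∁P _ (x-int v Gxv))))

  switch-enlarges : ∀ {T} → P ⊆ T → Q ⊆ ∁ T → cut G T < cut G′ T
  switch-enlarges {T} P⊆T Q⊆∁T = begin-strict
    cut G T                                      <⟨ m<m+n (cut G T) (s≤s z≤n) ⟩
    cut G T + 2                                  ≡⟨ cong (cut G T +_) uncut ⟨
    cut G T + (crossing T u y + crossing T x v)  ≡⟨ edgeSum-switch (crossing T) ⟨
    cut G′ T + (crossing T u v + crossing T x y) ≡⟨ cong (cut G′ T +_) kept ⟩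
    cut G′ T + 0                                 ≡⟨ +-identityʳ _ ⟩
    cut G′ T                                     ∎
    where
    open ≤-Reasoning
    Tx = not-true (Q⊆∁T _ Qx)
    Ty = not-true (Q⊆∁T _ Qy)
    uncut : crossing T u y + crossing T x v ≡ 2
    uncut rewrite P⊆T _ Pu | P⊆T _ Pv | Tx | Ty = refl
    kept : crossing T u v + crossing T x y ≡ 0
    kept rewrite P⊆T _ Pu | P⊆T _ Pv | Tx | Ty = refl

  private
    -- Whichever end of `uv` lies in `S` is taken as `w₁`.
    splitP : ∀ S → S (inj₁ u) ≡ not (S (inj₂ v)) → 3 + k ≤ 2 * split G P S
    splitP S u≠v with S (inj₂ v) in Sv
    ... | true  = good⇒split G P-min S Pv Pu Sv u≠v A⊆P A-min Av Au good-v good-u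
    ... | false = good⇒split G P-min S Pu Pv u≠v Sv A⊆P A-min Au Av good-u good-v

    splitQ : ∀ S → S (inj₁ x) ≡ not (S (inj₂ y)) → 2 + k ≤ 2 * split G Q S
    splitQ S x≠y with S (inj₂ y) in Sy
    ... | true  = minimal⇒split G Q-min S Qy Qx Sy x≠y
    ... | false = minimal⇒split G Q-min S Qx Qy x≠y Sy

  -- A cut can shrink only if `S` separates both `u` from `v` and `x` from `y`. It then had at least
  -- `k + 3` edges and loses at most two.
  switch-notSmaller : ∀ S → cut G S ≤ cut G′ S ⊎ k < cut G′ S
  switch-notSmaller S with
    alternatives (S (inj₁ u)) (S (inj₂ v)) (S (inj₁ x)) (S (inj₂ y))
    where
    alternatives : ∀ a b c d → b2n (a xor b) + b2n (c xor d) ≤ b2n (a xor d) + b2n (c xor b) ⊎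
      (a ≡ not b × c ≡ not d)
    alternatives = toWitness {a? = ∀ᵇ? λ _ → ∀ᵇ? λ _ → ∀ᵇ? λ _ → ∀ᵇ? λ _ →
      _ ≤? _ ⊎-dec (_ ≟ᵇ _ ×-dec _ ≟ᵇ _)} _
  ... | inj₁ le = inj₁ (squeeze (≤-reflexive (sym (edgeSum-switch (crossing S)))) le)
  ... | inj₂ (u≠v , x≠y) = inj₂ (squeeze {b = 2} (begin
    suc k + 2                                    ≡⟨ +-comm (suc k) 2 ⟩
    -- Twice the cut is at least `2k + 5`, so by parity the cut is at least `k + 3`; this is where
    -- the extra one from the good ends counts.
    3 + k                                        ≤⟨ *-cancelˡ-< 2 (2 + k) _ doubled ⟩
    cut G S                                      ≤⟨ m≤m+n _ _ ⟩
    cut G S + (crossing S u y + crossing S x v)  ≡⟨ edgeSum-switch (crossing S) ⟨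
    cut G′ S + (crossing S u v + crossing S x y) ≤⟨ +-monoʳ-≤ (cut G′ S) (+-mono-≤ (b2n≤1 (S (inj₁ u) xor S (inj₂ v))) (b2n≤1 (S (inj₁ x) xor S (inj₂ y)))) ⟩
    cut G′ S + 2                                 ∎) ≤-refl)
    where
    open ≤-Reasoning
    doubled : 2 * (2 + k) < 2 * cut G S
    doubled = begin-strict
      2 * (2 + k)                           ≡⟨ cong ((2 + k) +_) (+-identityʳ (2 + k)) ⟩
      (2 + k) + (2 + k)                     <⟨ +-mono-<-≤ (splitP S u≠v) (splitQ S x≠y) ⟩
      2 * split G P S + 2 * split G Q S     ≡⟨ *-distribˡ-+ 2 (split G P S) (split G Q S) ⟨
      2 * (split G P S + split G Q S)       ≤⟨ *-monoʳ-≤ 2 (split+split≤cut G {P} {Q} S Q⊆∁P) ⟩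
      2 * cut G S                           ∎

  switch-enlargeCut : ∀ {T} → P ⊆ T → Q ⊆ ∁ T → cut G T ≡ k →
    ∃ λ H → SameDegrees G H × k < cut H T × (∀ S → cut G S ≤ cut H S ⊎ k < cut H S)
  switch-enlargeCut P⊆T Q⊆∁T refl =
    G′ , (degX-switch , degY-switch) , switch-enlarges P⊆T Q⊆∁T , switch-notSmaller

abstract
  enlargeCut : ∀ {n m μ k} (G : BipGraph n m) → 3 ≤ μ → k < μ → (∀ v → μ ≤ deg G v) →
    ∀ T → Nonempty T → Nonempty (∁ T) → cut G T ≡ k →
    ∃ λ H → SameDegrees G H × k < cut H T × (∀ S → cut G S ≤ cut H S ⊎ k < cut H S)
  enlargeCut {k = k} G 3≤μ k<μ μ≤deg T T≠∅ ∁T≠∅ cutT≡k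
    with minimalSmallCut G k T (T≠∅ , ≤-reflexive cutT≡k)
       | minimalSmallCut G k (∁ T) (∁T≠∅ , ≤-reflexive (trans (cut-∁ G T) cutT≡k))
  ... | P , P⊆T , P-min@((P≠∅ , cutP≤k) , _) | Q , Q⊆∁T , Q-min@((Q≠∅ , cutQ≤k) , _) =
    -- The cut of `P` is below every degree, so `P` contains an edge and is itself a thin set from
    -- which to descend.
    let i , j , Gij , Pi , Pj , _ = internalEdge G P P≠∅ (cut<deg P cutP≤k)
        A , A⊆P , A-min = minimalThin G k P ((i , j , Gij , Pi , Pj) , m≤n⇒m≤1+n cutP≤k)
    in atThinSet A A⊆P A-min
    where
    cut<deg : ∀ S → cut G S ≤ k → ∀ v → cut G S < deg G v
    cut<deg S le v = <-≤-trans (≤-<-trans le k<μ) (μ≤deg v)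

    Q⊆∁P : Q ⊆ ∁ P
    Q⊆∁P w Qw = cong not (¬-not λ Pw → true≢false (P⊆T w Pw) (not-true (Q⊆∁T w Qw)))

    atThinSet : ∀ A → A ⊆ P → Minimal (ThinWithEdge G k) A →
      ∃ λ H → SameDegrees G H × k < cut H T × (∀ S → cut G S ≤ cut H S ⊎ k < cut H S)
    atThinSet A A⊆P A-min@((edgeA , cutA≤) , _)
      with goodEdge G 3≤μ k<μ μ≤deg cutP≤k A⊆P cutA≤ edgeA | internalEdge G Q Q≠∅ (cut<deg Q cutQ≤k)
    ... | u , v , Guv , Au , Av , good-u , good-v | x , y , Gxy , Qx , Qy , x-int , y-int =
      switch-enlargeCut G P-min Q-min Q⊆∁P A⊆P A-min Guv Au Av good-u good-v Gxy Qx Qy x-int y-int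
        P⊆T Q⊆∁T cutT≡k

-- Iteration over all vertex sets and all values of `k`

AllCuts≥ : ∀ {n m} → ℕ → BipGraph n m → Set
AllCuts≥ k G = ∀ S → Nonempty S → Nonempty (∁ S) → k ≤ cut G S

CutAbove : ∀ {n m} → ℕ → BipGraph n m → VSubset n m → Set
CutAbove k G S = Nonempty S → Nonempty (∁ S) → k < cut G S

module _ {μ n m} (3≤μ : 3 ≤ μ) {xs : Fin n → ℕ} {ys : Fin m → ℕ}
  (graphic : BipartiteGraphic xs ys) (μ≤xs : ∀ i → μ ≤ xs i) (μ≤ys : ∀ j → μ ≤ ys j) where

  realizes⇒deg : ∀ {G} → Realizes G xs ys → ∀ v → μ ≤ deg G v
  realizes⇒deg {G} (degX≡ , _) (inj₁ i) = subst (μ ≤_) (sym (trans (deg≡degX G i) (degX≡ i))) (μ≤xs i)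
  realizes⇒deg {G} (_ , degY≡) (inj₂ j) = subst (μ ≤_) (sym (trans (deg≡degY G j) (degY≡ j))) (μ≤ys j)

  -- The tail is treated first. The step for `T` cannot undo it, because `enlargeCut` keeps every
  -- cut that exceeds `k` above `k`.
  enlargeCuts : ∀ {k} → k < μ → ∃ (λ G → Realizes G xs ys × AllCuts≥ k G) → (L : List (VSubset n m)) →
    ∃ λ G → Realizes G xs ys × AllCuts≥ k G × All (CutAbove k G) L
  enlargeCuts k<μ (G , real , cuts) [] = G , real , cuts , []
  enlargeCuts {k} k<μ start (T ∷ L) with enlargeCuts k<μ start L
  ... | G , real , cuts , above with nonempty? T | nonempty? (∁ T)
  ...   | no empty | _ = G , real , cuts , (λ T≠∅ _ → contradiction T≠∅ empty) ∷ above
  ...   | yes _ | no full = G , real , cuts , (λ _ ∁T≠∅ → contradiction ∁T≠∅ full) ∷ above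
  ...   | yes T≠∅ | yes ∁T≠∅ with k <? cut G T
  ...     | yes k<cut = G , real , cuts , (λ _ _ → k<cut) ∷ above
  ...     | no k≮cut
    with enlargeCut G 3≤μ k<μ (realizes⇒deg {G} real) T T≠∅ ∁T≠∅ (≤-antisym (≮⇒≥ k≮cut) (cuts T T≠∅ ∁T≠∅))
  ...     | H , (degX≡ , degY≡) , k<cutT , notSmaller =
    H , ((λ i → trans (degX≡ i) (proj₁ real i)) , (λ j → trans (degY≡ j) (proj₂ real j))) ,
    (λ S S≠∅ ∁S≠∅ → [ ≤-trans (cuts S S≠∅ ∁S≠∅) , <⇒≤ ] (notSmaller S)) ,
    (λ _ _ → k<cutT) ∷
    All.map (λ {S} above S≠∅ ∁S≠∅ → [ <-≤-trans (above S≠∅ ∁S≠∅) , (λ lt → lt) ] (notSmaller S)) above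

  connectedRealization : ∀ k → k ≤ μ → ∃ λ G → Realizes G xs ys × AllCuts≥ k G
  connectedRealization zero    _   = proj₁ graphic , proj₂ graphic , λ _ _ _ → z≤n
  connectedRealization (suc k) k<μ
    with enlargeCuts k<μ (connectedRealization k (<⇒≤ k<μ)) (allSubsets n m)
  ... | G , real , _ , above = G , real , λ S (v , Sv) (w , ∁Sw) →
    -- The list contains a set that agrees with `S` pointwise and so has the same cut.
    let above-T , T≗S = All.lookupAny above (allSubsets-complete S)
    in subst (k <_) (cut-cong G T≗S)
         (above-T (v , trans (T≗S v) Sv) (w , trans (cong not (T≗S w)) ∁Sw))

theorem2p5 : (μ : ℕ) → 3 ≤ μ → (n m : ℕ) → (xs : Fin n → ℕ) → (ys : Fin m → ℕ) →
    BipartiteGraphic xs ys →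
    (∀ i → μ ∸ 1 < xs i) → (∀ j → μ ∸ 1 < ys j) →
    Σ (BipGraph n m) (λ G → Realizes G xs ys × EdgeConnected μ G)
theorem2p5 μ 3≤μ n m xs ys graphic μ-1<xs μ-1<ys =
  let G , real , cuts = connectedRealization 3≤μ graphic
        -- The strict bound unfolds to `1 + (μ ∸ 1) ≤ xs i`, and `μ ≤ 1 + (μ ∸ 1)`.
        (λ i → ≤-trans (m≤n+m∸n μ 1) (μ-1<xs i)) (λ j → ≤-trans (m≤n+m∸n μ 1) (μ-1<ys j)) μ ≤-refl
  in G , real , λ S ((v , Sv) , (w , Sw)) →
       subst (μ ≤_) (sym (cutSize≡cut G S)) (cuts S (v , Sv) (w , cong not Sw))
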